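{- Assume the following statement: there is an algorithm which takes as input a Diophantine equation $D(x_1,\ldots,x_p)=0$ and returns an integer $b\geqslant 2$ such that $b$ is greater than the number of rational solutions of the equation whenever the set of its rational solutions is finite. Then the question whether or not a given Diophantine equation has only finitely many rational solutions is decidable by a single query to an oracle that decides whether or not a given Diophantine equation has a rational solution.
   Context: A Diophantine equation is an equation $D(x_1,\ldots,x_p)=0$ with $D \in \mathbb{Z}[x_1,\ldots,x_p]$. -}

module Defs where

open import Data.Nat using (ℕ; _<_; _≤_)
open import Data.Integer using (ℤ)
open import Data.Fin using (Fin)
open import Data.Vec using (Vec; lookup)
open import Data.List using (List; length)
open import Data.List.Membership.Propositional using (_∈_)
open import Data.List.Relation.Unary.All using (All)
open import Data.List.Relation.Unary.Unique.Propositional using (Unique)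
open import Data.Product using (∃; _×_)
open import Data.Bool using (Bool; true)
open import Data.Rational using (ℚ; 0ℚ; _/_) renaming (_+_ to _+ℚ_; _*_ to _*ℚ_)
open import Relation.Binary.PropositionalEquality using (_≡_)

-- A Diophantine equation D(x_1,…,x_p) = 0 is given by a polynomial
-- D ∈ ℤ[x_1,…,x_p], presented (as algorithmic input) by a polynomial expression.
data Poly (p : ℕ) : Set where
  con  : ℤ → Poly p
  var  : Fin p → Poly p
  _⊕_  : Poly p → Poly p → Poly p
  _⊗_  : Poly p → Poly p → Poly p

evalℚ : {p : ℕ} → Poly p → Vec ℚ p → ℚ
evalℚ (con z)  x = z / 1
evalℚ (var i)  x = lookup x i
evalℚ (d ⊕ e)  x = evalℚ d x +ℚ evalℚ e x
evalℚ (d ⊗ e)  x = evalℚ d x *ℚ evalℚ e x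

IsRatSol : {p : ℕ} → Poly p → Vec ℚ p → Set
IsRatSol D x = evalℚ D x ≡ 0ℚ

HasRatSol : {p : ℕ} → Poly p → Set
HasRatSol {p} D = ∃ λ (x : Vec ℚ p) → IsRatSol D x

FinitelyManyRatSols : {p : ℕ} → Poly p → Set
FinitelyManyRatSols {p} D = ∃ λ (L : List (Vec ℚ p)) → ∀ x → IsRatSol D x → x ∈ L

NumRatSols< : {p : ℕ} → Poly p → ℕ → Set
NumRatSols< {p} D b = ∀ (L : List (Vec ℚ p)) → Unique L → All (IsRatSol D) L → length L < b

IsRatSolvabilityOracle : ((q : ℕ) → Poly q → Bool) → Set
IsRatSolvabilityOracle O = ∀ q (E : Poly q) → (O q E ≡ true → HasRatSol E) × (HasRatSol E → O q E ≡ true)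

{-# OPTIONS --safe #-}
-- For each k there is a Diophantine equation, computable from D and k, that has a rational
-- solution iff D = 0 has at least k distinct rational solutions: take k copies x₁,…,x_k of
-- the variables, ask D(x_j) = 0, and ask t_jl · Σᵢ (x_ji − x_li)² = 1 for j ≠ l, which is
-- solvable in t_jl exactly when x_j ≠ x_l. A single query, with k = b, then decides
-- finiteness: finitely many solutions means fewer than b of them; conversely, if there are
-- fewer than b, then walking down from b the oracle's own answers (which make "has k
-- distinct solutions" decidable) find some k with k solutions but not k + 1, and those k
-- solutions are all of them.
module Submission where

open import Defs
open import Data.Nat using (ℕ; _≤_)
open import Data.Bool using (Bool; true)
open import Data.Product using (Σ; ∃; _×_)
open import Relation.Binary.PropositionalEquality using (_≡_)

import Data.Nat as ℕ
open import Data.Nat.Properties using (<-irrefl)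
open import Data.Bool using (false; not)
open import Data.Integer as ℤ using (-[1+_])
open import Data.Fin as Fin using (Fin; zero; suc; _↑ˡ_; _↑ʳ_; combine; remQuot; splitAt)
import Data.Fin.Properties as Finₚ
open import Data.Vec as Vec using (Vec)
import Data.Vec.Properties as Vecₚ
open import Data.List as List using (List; []; _∷_; length)
open import Data.List.Properties using (length-tabulate)
open import Data.List.Relation.Unary.All as All using (All; []; _∷_)
import Data.List.Relation.Unary.All.Properties as Allₚ
open import Data.List.Relation.Unary.AllPairs using ([]; _∷_)
open import Data.List.Relation.Unary.Unique.Propositional using (Unique)
import Data.List.Relation.Unary.Unique.Propositional.Properties as Uniqueₚ
open import Data.List.Membership.Propositional.Properties using (∈-lookup)
open import Data.Product using (_,_; proj₁; proj₂; uncurry)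
open import Data.Sum using ([_,_]′; inj₁; inj₂)
open import Data.Empty using (⊥-elim)
open import Function using (_∘_; case_of_)
open import Relation.Nullary using (Dec; yes; no; ¬_)
open import Relation.Nullary.Decidable using (map′)
open import Relation.Unary using (Decidable)
open import Relation.Binary.PropositionalEquality
  using (refl; sym; trans; cong; cong₂; subst; subst₂; module ≡-Reasoning)
open import Data.Rational as ℚ using (ℚ; 0ℚ; 1ℚ; _+_; _*_; _-_; 1/_)
import Data.Rational.Properties as ℚₚ
open import Algebra.Properties.Group ℚₚ.+-0-group using (x∙y⁻¹≈ε⇒x≈y; x≈y⇒x∙y⁻¹≈ε)
open import Algebra.Properties.Ring ℚₚ.+-*-ring using (-1*x≈-x)

square-nonNeg : ∀ a → 0ℚ ℚ.≤ a * a
square-nonNeg a with ℚₚ.≤-total 0ℚ a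
... | inj₁ 0≤a = subst (ℚ._≤ a * a) (ℚₚ.*-zeroʳ a) (ℚₚ.*-monoˡ-≤-nonNeg a {{ℚ.nonNegative 0≤a}} 0≤a)
... | inj₂ a≤0 = subst (ℚ._≤ a * a) (ℚₚ.*-zeroʳ a) (ℚₚ.*-monoˡ-≤-nonPos a {{ℚ.nonPositive a≤0}} a≤0)

square≡0⇒≡0 : ∀ a → a * a ≡ 0ℚ → a ≡ 0ℚ
square≡0⇒≡0 a a²≡0 with a ℚ.≟ 0ℚ
... | yes a≡0 = a≡0
... | no a≢0 = begin
  a                ≡⟨ sym (ℚₚ.*-identityˡ a) ⟩
  1ℚ * a           ≡⟨ cong (_* a) (sym (ℚₚ.*-inverseˡ a)) ⟩
  (1/ a * a) * a   ≡⟨ ℚₚ.*-assoc (1/ a) a a ⟩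
  1/ a * (a * a)   ≡⟨ cong (1/ a *_) a²≡0 ⟩
  1/ a * 0ℚ        ≡⟨ ℚₚ.*-zeroʳ (1/ a) ⟩
  0ℚ               ∎
  where
  open ≡-Reasoning
  instance
    a-nonZero : ℚ.NonZero a
    a-nonZero = ℚ.≢-nonZero a≢0

nonNeg+nonNeg≡0⇒≡0 : ∀ {a b} → 0ℚ ℚ.≤ a → 0ℚ ℚ.≤ b → a + b ≡ 0ℚ → a ≡ 0ℚ × b ≡ 0ℚ
nonNeg+nonNeg≡0⇒≡0 {a} {b} 0≤a 0≤b a+b≡0 =
  ℚₚ.≤-antisym (subst₂ ℚ._≤_ (ℚₚ.+-identityʳ a) a+b≡0 (ℚₚ.+-monoʳ-≤ a 0≤b)) 0≤a ,
  ℚₚ.≤-antisym (subst₂ ℚ._≤_ (ℚₚ.+-identityˡ b) a+b≡0 (ℚₚ.+-monoˡ-≤ b 0≤a)) 0≤b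

sumSq : ∀ {n} → (Fin n → ℚ) → ℚ
sumSq {ℕ.zero}  g = 0ℚ
sumSq {ℕ.suc n} g = g zero * g zero + sumSq (g ∘ suc)

sumSq-cong : ∀ {n} {g h : Fin n → ℚ} → (∀ i → g i ≡ h i) → sumSq g ≡ sumSq h
sumSq-cong {ℕ.zero}  g≗h = refl
sumSq-cong {ℕ.suc n} g≗h = cong₂ _+_ (cong₂ _*_ (g≗h zero) (g≗h zero)) (sumSq-cong (g≗h ∘ suc))

sumSq-nonNeg : ∀ {n} (g : Fin n → ℚ) → 0ℚ ℚ.≤ sumSq g
sumSq-nonNeg {ℕ.zero}  g = ℚₚ.≤-refl
sumSq-nonNeg {ℕ.suc n} g =
  subst (ℚ._≤ sumSq g) (ℚₚ.+-identityˡ 0ℚ) (ℚₚ.+-mono-≤ (square-nonNeg (g zero)) (sumSq-nonNeg (g ∘ suc)))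

sumSq≡0⇒≡0 : ∀ {n} (g : Fin n → ℚ) → sumSq g ≡ 0ℚ → ∀ i → g i ≡ 0ℚ
sumSq≡0⇒≡0 {ℕ.suc n} g Σ≡0 i
  with nonNeg+nonNeg≡0⇒≡0 (square-nonNeg (g zero)) (sumSq-nonNeg (g ∘ suc)) Σ≡0 | i
... | g₀²≡0 , _ | zero   = square≡0⇒≡0 (g zero) g₀²≡0
... | _ , rest≡0 | suc i = sumSq≡0⇒≡0 (g ∘ suc) rest≡0 i

sumSq-zeros : ∀ {n} (g : Fin n → ℚ) → (∀ i → g i ≡ 0ℚ) → sumSq g ≡ 0ℚ
sumSq-zeros {ℕ.zero}  g g≗0 = refl
sumSq-zeros {ℕ.suc n} g g≗0 rewrite g≗0 zero | sumSq-zeros (g ∘ suc) (g≗0 ∘ suc) = refl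

sqDist : ∀ {n} → (Fin n → ℚ) → (Fin n → ℚ) → ℚ
sqDist u v = sumSq (λ i → u i - v i)

sqDist≡0⇒≗ : ∀ {n} (u v : Fin n → ℚ) → sqDist u v ≡ 0ℚ → ∀ i → u i ≡ v i
sqDist≡0⇒≗ u v d≡0 i = x∙y⁻¹≈ε⇒x≈y (u i) (v i) (sumSq≡0⇒≡0 _ d≡0 i)

≗⇒sqDist≡0 : ∀ {n} (u v : Fin n → ℚ) → (∀ i → u i ≡ v i) → sqDist u v ≡ 0ℚ
≗⇒sqDist≡0 u v u≗v = sumSq-zeros _ (x≈y⇒x∙y⁻¹≈ε ∘ u≗v)

⟦_⟧ : ∀ {q} → Poly q → (Fin q → ℚ) → ℚ
⟦ con z ⟧ ρ = z ℚ./ 1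
⟦ var i ⟧ ρ = ρ i
⟦ E ⊕ F ⟧ ρ = ⟦ E ⟧ ρ + ⟦ F ⟧ ρ
⟦ E ⊗ F ⟧ ρ = ⟦ E ⟧ ρ * ⟦ F ⟧ ρ

evalℚ≡⟦⟧ : ∀ {q} (E : Poly q) v → evalℚ E v ≡ ⟦ E ⟧ (Vec.lookup v)
evalℚ≡⟦⟧ (con z) v = refl
evalℚ≡⟦⟧ (var i) v = refl
evalℚ≡⟦⟧ (E ⊕ F) v = cong₂ _+_ (evalℚ≡⟦⟧ E v) (evalℚ≡⟦⟧ F v)
evalℚ≡⟦⟧ (E ⊗ F) v = cong₂ _*_ (evalℚ≡⟦⟧ E v) (evalℚ≡⟦⟧ F v)

⟦⟧-cong : ∀ {q} (E : Poly q) {ρ σ : Fin q → ℚ} → (∀ i → ρ i ≡ σ i) → ⟦ E ⟧ ρ ≡ ⟦ E ⟧ σ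
⟦⟧-cong (con z) ρ≗σ = refl
⟦⟧-cong (var i) ρ≗σ = ρ≗σ i
⟦⟧-cong (E ⊕ F) ρ≗σ = cong₂ _+_ (⟦⟧-cong E ρ≗σ) (⟦⟧-cong F ρ≗σ)
⟦⟧-cong (E ⊗ F) ρ≗σ = cong₂ _*_ (⟦⟧-cong E ρ≗σ) (⟦⟧-cong F ρ≗σ)

evalℚ-tabulate : ∀ {q} (E : Poly q) ρ → evalℚ E (Vec.tabulate ρ) ≡ ⟦ E ⟧ ρ
evalℚ-tabulate E ρ = trans (evalℚ≡⟦⟧ E _) (⟦⟧-cong E (Vecₚ.lookup∘tabulate ρ))

rename : ∀ {p q} → (Fin p → Fin q) → Poly p → Poly q
rename f (con z) = con z
rename f (var i) = var (f i)
rename f (E ⊕ F) = rename f E ⊕ rename f F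
rename f (E ⊗ F) = rename f E ⊗ rename f F

⟦rename⟧ : ∀ {p q} (f : Fin p → Fin q) (E : Poly p) ρ → ⟦ rename f E ⟧ ρ ≡ ⟦ E ⟧ (ρ ∘ f)
⟦rename⟧ f (con z) ρ = refl
⟦rename⟧ f (var i) ρ = refl
⟦rename⟧ f (E ⊕ F) ρ = cong₂ _+_ (⟦rename⟧ f E ρ) (⟦rename⟧ f F ρ)
⟦rename⟧ f (E ⊗ F) ρ = cong₂ _*_ (⟦rename⟧ f E ρ) (⟦rename⟧ f F ρ)

_⊖_ : ∀ {q} → Poly q → Poly q → Poly q
E ⊖ F = E ⊕ (con -[1+ 0 ] ⊗ F)

⟦⊖⟧ : ∀ {q} (E F : Poly q) ρ → ⟦ E ⊖ F ⟧ ρ ≡ ⟦ E ⟧ ρ - ⟦ F ⟧ ρ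
⟦⊖⟧ E F ρ = cong (⟦ E ⟧ ρ +_) (-1*x≈-x (⟦ F ⟧ ρ))

-- Over ℚ a sum of squares vanishes iff every term does, so ⋀ f expresses the
-- conjunction of the equations f i = 0.
⋀ : ∀ {n q} → (Fin n → Poly q) → Poly q
⋀ {ℕ.zero}  f = con (ℤ.+ 0)
⋀ {ℕ.suc n} f = (f zero ⊗ f zero) ⊕ ⋀ (f ∘ suc)

⟦⋀⟧ : ∀ {n q} (f : Fin n → Poly q) ρ → ⟦ ⋀ f ⟧ ρ ≡ sumSq (λ i → ⟦ f i ⟧ ρ)
⟦⋀⟧ {ℕ.zero}  f ρ = refl
⟦⋀⟧ {ℕ.suc n} f ρ = cong (⟦ f zero ⟧ ρ * ⟦ f zero ⟧ ρ +_) (⟦⋀⟧ (f ∘ suc) ρ)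

⟦⋀⟧≡0⇒ : ∀ {n q} (f : Fin n → Poly q) ρ → ⟦ ⋀ f ⟧ ρ ≡ 0ℚ → ∀ i → ⟦ f i ⟧ ρ ≡ 0ℚ
⟦⋀⟧≡0⇒ f ρ ⋀≡0 = sumSq≡0⇒≡0 _ (trans (sym (⟦⋀⟧ f ρ)) ⋀≡0)

⟦⋀⟧≡0⇐ : ∀ {n q} (f : Fin n → Poly q) ρ → (∀ i → ⟦ f i ⟧ ρ ≡ 0ℚ) → ⟦ ⋀ f ⟧ ρ ≡ 0ℚ
⟦⋀⟧≡0⇐ f ρ f≡0 = trans (⟦⋀⟧ f ρ) (sumSq-zeros _ f≡0)

-- t · Σᵢ (xᵢ − yᵢ)² = 1 is solvable in t exactly when x ≠ y.
apart : ∀ {p q} → Fin q → (Fin p → Fin q) → (Fin p → Fin q) → Poly q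
apart t x y = (var t ⊗ ⋀ (λ i → var (x i) ⊖ var (y i))) ⊖ con (ℤ.+ 1)

⟦apart⟧ : ∀ {p q} t (x y : Fin p → Fin q) ρ → ⟦ apart t x y ⟧ ρ ≡ ρ t * sqDist (ρ ∘ x) (ρ ∘ y) - 1ℚ
⟦apart⟧ {p} {q} t x y ρ = begin
  ⟦ (var t ⊗ ⋀ diffs) ⊖ con (ℤ.+ 1) ⟧ ρ   ≡⟨ ⟦⊖⟧ (var t ⊗ ⋀ diffs) (con (ℤ.+ 1)) ρ ⟩
  ρ t * ⟦ ⋀ diffs ⟧ ρ - 1ℚ                ≡⟨ cong (λ s → ρ t * s - 1ℚ) (⟦⋀⟧ diffs ρ) ⟩
  ρ t * sumSq (λ i → ⟦ diffs i ⟧ ρ) - 1ℚ  ≡⟨ cong (λ s → ρ t * s - 1ℚ) (sumSq-cong λ i → ⟦⊖⟧ (var (x i)) (var (y i)) ρ) ⟩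
  ρ t * sqDist (ρ ∘ x) (ρ ∘ y) - 1ℚ       ∎
  where
  open ≡-Reasoning
  diffs : Fin p → Poly q
  diffs i = var (x i) ⊖ var (y i)

⟦apart⟧≡0⇒≢ : ∀ {p q} t (x y : Fin p → Fin q) ρ → ⟦ apart t x y ⟧ ρ ≡ 0ℚ → ¬ (∀ i → ρ (x i) ≡ ρ (y i))
⟦apart⟧≡0⇒≢ t x y ρ apart≡0 x≗y = ℚₚ.1≢0 (begin
  1ℚ                             ≡⟨ sym (x∙y⁻¹≈ε⇒x≈y _ 1ℚ (trans (sym (⟦apart⟧ t x y ρ)) apart≡0)) ⟩
  ρ t * sqDist (ρ ∘ x) (ρ ∘ y)   ≡⟨ cong (ρ t *_) (≗⇒sqDist≡0 _ _ x≗y) ⟩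
  ρ t * 0ℚ                       ≡⟨ ℚₚ.*-zeroʳ (ρ t) ⟩
  0ℚ                             ∎)
  where open ≡-Reasoning

⟦apart⟧≡0⇐ : ∀ {p q} t (x y : Fin p → Fin q) ρ → ρ t * sqDist (ρ ∘ x) (ρ ∘ y) ≡ 1ℚ → ⟦ apart t x y ⟧ ρ ≡ 0ℚ
⟦apart⟧≡0⇐ t x y ρ t·d≡1 = trans (⟦apart⟧ t x y ρ) (x≈y⇒x∙y⁻¹≈ε t·d≡1)

-- Variables of the system: the coordinates x_ji of k points of ℚ^p, then the k² unknowns t_jl.
#vars : ℕ → ℕ → ℕ
#vars p k = k ℕ.* p ℕ.+ k ℕ.* k

xvar : ∀ {p k} → Fin k → Fin p → Fin (#vars p k)
xvar {p} {k} j i = combine j i ↑ˡ (k ℕ.* k)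

tvar : ∀ {p k} → Fin k → Fin k → Fin (#vars p k)
tvar {p} {k} j l = (k ℕ.* p) ↑ʳ combine j l

env : ∀ {p k} → (Fin k → Fin p → ℚ) → (Fin k → Fin k → ℚ) → Fin (#vars p k) → ℚ
env {p} {k} x t = [ uncurry x ∘ remQuot p , uncurry t ∘ remQuot k ]′ ∘ splitAt (k ℕ.* p)

env-xvar : ∀ {p k} x t (j : Fin k) (i : Fin p) → env x t (xvar j i) ≡ x j i
env-xvar {p} {k} x t j i
  rewrite Finₚ.splitAt-↑ˡ (k ℕ.* p) (combine j i) (k ℕ.* k) = cong (uncurry x) (Finₚ.remQuot-combine j i)

env-tvar : ∀ {p k} x t (j l : Fin k) → env {p} x t (tvar j l) ≡ t j l
env-tvar {p} {k} x t j l
  rewrite Finₚ.splitAt-↑ʳ (k ℕ.* p) (k ℕ.* k) (combine j l) = cong (uncurry t) (Finₚ.remQuot-combine j l)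

condition : ∀ {p k} → Poly p → (j l : Fin k) → Dec (j ≡ l) → Poly (#vars p k)
condition D j l (yes _) = rename (xvar j) D
condition D j l (no _)  = apart (tvar j l) (xvar j) (xvar l)

row : ∀ {p} → Poly p → (k : ℕ) → Fin k → Poly (#vars p k)
row D k j = ⋀ λ l → condition D j l (j Fin.≟ l)

system : ∀ {p} → Poly p → (k : ℕ) → Poly (#vars p k)
system D k = ⋀ (row D k)

⟦condition-diag⟧ : ∀ {p k} (D : Poly p) (j : Fin k) d ρ → ⟦ condition D j j d ⟧ ρ ≡ 0ℚ → ⟦ D ⟧ (ρ ∘ xvar j) ≡ 0ℚ
⟦condition-diag⟧ D j (yes _) ρ c≡0 = trans (sym (⟦rename⟧ (xvar j) D ρ)) c≡0
⟦condition-diag⟧ D j (no j≢j) ρ _ = ⊥-elim (j≢j refl)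

⟦condition⟧-separates : ∀ {p k} (D : Poly p) (j l : Fin k) d ρ →
  ⟦ condition D j l d ⟧ ρ ≡ 0ℚ → (∀ i → ρ (xvar j i) ≡ ρ (xvar l i)) → j ≡ l
⟦condition⟧-separates D j l (yes j≡l) ρ _ _ = j≡l
⟦condition⟧-separates D j l (no _) ρ c≡0 x≗y = ⊥-elim (⟦apart⟧≡0⇒≢ (tvar j l) (xvar j) (xvar l) ρ c≡0 x≗y)

HasDistinctRatSols : ∀ {p} → Poly p → ℕ → Set
HasDistinctRatSols {p} D k = Σ (List (Vec ℚ p)) λ L → length L ≡ k × Unique L × All (IsRatSol D) L

system-sound : ∀ {p} (D : Poly p) k → HasRatSol (system D k) → HasDistinctRatSols D k
system-sound {p} D k (v , v-sol) =
  List.tabulate point , length-tabulate point , Uniqueₚ.tabulate⁺ point-injective , Allₚ.tabulate⁺ point-sol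
  where
  ρ : Fin (#vars p k) → ℚ
  ρ = Vec.lookup v

  holds : ∀ j l → ⟦ condition D j l (j Fin.≟ l) ⟧ ρ ≡ 0ℚ
  holds j l = ⟦⋀⟧≡0⇒ (λ l → condition D j l (j Fin.≟ l)) ρ
    (⟦⋀⟧≡0⇒ (row D k) ρ (trans (sym (evalℚ≡⟦⟧ (system D k) v)) v-sol) j) l

  point : Fin k → Vec ℚ p
  point j = Vec.tabulate (ρ ∘ xvar j)

  point-sol : ∀ j → IsRatSol D (point j)
  point-sol j = trans (evalℚ-tabulate D _) (⟦condition-diag⟧ D j (j Fin.≟ j) ρ (holds j j))

  point-injective : ∀ {j l} → point j ≡ point l → j ≡ l
  point-injective {j} {l} pj≡pl = ⟦condition⟧-separates D j l (j Fin.≟ l) ρ (holds j l) λ i →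
    trans (sym (Vecₚ.lookup∘tabulate _ i)) (trans (cong (λ u → Vec.lookup u i) pj≡pl) (Vecₚ.lookup∘tabulate _ i))

lookup-injective : ∀ {A : Set} {xs : List A} → Unique xs → ∀ i j → List.lookup xs i ≡ List.lookup xs j → i ≡ j
lookup-injective (_ ∷ _)       zero    zero    _ = refl
lookup-injective (x∉xs ∷ _)    zero    (suc j) e = ⊥-elim (All.lookup x∉xs (∈-lookup j) e)
lookup-injective (x∉xs ∷ _)    (suc i) zero    e = ⊥-elim (All.lookup x∉xs (∈-lookup i) (sym e))
lookup-injective (_ ∷ unique)  (suc i) (suc j) e = cong suc (lookup-injective unique i j e)

system-complete : ∀ {p} (D : Poly p) k → HasDistinctRatSols D k → HasRatSol (system D k)
system-complete {p} D _ (L , refl , unique , sols) =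
  Vec.tabulate σ , trans (evalℚ-tabulate (system D k) σ)
    (⟦⋀⟧≡0⇐ (row D k) σ λ j → ⟦⋀⟧≡0⇐ (λ l → condition D j l (j Fin.≟ l)) σ λ l →
      holds j l (j Fin.≟ l) (env-tvar x t j l))
  where
  k : ℕ
  k = length L

  x : Fin k → Fin p → ℚ
  x j = Vec.lookup (List.lookup L j)

  sqDist≢0 : ∀ {j l} → ¬ j ≡ l → ¬ sqDist (x j) (x l) ≡ 0ℚ
  sqDist≢0 {j} {l} j≢l d≡0 = j≢l (lookup-injective unique j l (begin
    List.lookup L j                  ≡⟨ sym (Vecₚ.tabulate∘lookup _) ⟩
    Vec.tabulate (x j)               ≡⟨ Vecₚ.tabulate-cong (sqDist≡0⇒≗ (x j) (x l) d≡0) ⟩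
    Vec.tabulate (x l)               ≡⟨ Vecₚ.tabulate∘lookup _ ⟩
    List.lookup L l                  ∎))
    where open ≡-Reasoning

  inverse : (j l : Fin k) → Dec (j ≡ l) → ℚ
  inverse j l (yes _)  = 0ℚ
  inverse j l (no j≢l) = 1/_ (sqDist (x j) (x l)) {{ℚ.≢-nonZero (sqDist≢0 j≢l)}}

  t : Fin k → Fin k → ℚ
  t j l = inverse j l (j Fin.≟ l)

  σ : Fin (#vars p k) → ℚ
  σ = env x t

  σ∘xvar : ∀ j i → σ (xvar j i) ≡ x j i
  σ∘xvar = env-xvar x t

  holds : ∀ j l d → σ (tvar j l) ≡ inverse j l d → ⟦ condition D j l d ⟧ σ ≡ 0ℚ
  holds j l (yes _) _ = begin
    ⟦ rename (xvar j) D ⟧ σ   ≡⟨ ⟦rename⟧ (xvar j) D σ ⟩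
    ⟦ D ⟧ (σ ∘ xvar j)        ≡⟨ ⟦⟧-cong D (σ∘xvar j) ⟩
    ⟦ D ⟧ (x j)               ≡⟨ sym (evalℚ≡⟦⟧ D _) ⟩
    evalℚ D (List.lookup L j) ≡⟨ All.lookup sols (∈-lookup j) ⟩
    0ℚ                        ∎
    where open ≡-Reasoning
  holds j l (no j≢l) σt≡t = ⟦apart⟧≡0⇐ (tvar j l) (xvar j) (xvar l) σ (begin
    σ (tvar j l) * sqDist (σ ∘ xvar j) (σ ∘ xvar l) ≡⟨ cong₂ _*_ σt≡t (sumSq-cong (λ i → cong₂ _-_ (σ∘xvar j i) (σ∘xvar l i))) ⟩
    inverse j l (no j≢l) * sqDist (x j) (x l)       ≡⟨ ℚₚ.*-inverseˡ (sqDist (x j) (x l)) {{ℚ.≢-nonZero (sqDist≢0 j≢l)}} ⟩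
    1ℚ                                              ∎)
    where open ≡-Reasoning

∃-boundary : ∀ {P : ℕ → Set} → Decidable P → P 0 → ∀ n → ¬ P n → ∃ λ k → P k × ¬ P (ℕ.suc k)
∃-boundary P? P0 ℕ.zero    ¬P0  = ⊥-elim (¬P0 P0)
∃-boundary P? P0 (ℕ.suc n) ¬Psn with P? n
... | yes Pn  = n , Pn , ¬Psn
... | no ¬Pn  = ∃-boundary P? P0 n ¬Pn

maximal⇒finite : ∀ {p} (D : Poly p) {k} → HasDistinctRatSols D k → ¬ HasDistinctRatSols D (ℕ.suc k) →
  FinitelyManyRatSols D
maximal⇒finite D (L , refl , unique , sols) ¬more = L , λ x x-sol → case x ∈? L of λ where
    (yes x∈L) → x∈L
    (no x∉L)  → ⊥-elim (¬more (x ∷ L , refl , Allₚ.¬Any⇒All¬ L x∉L ∷ unique , x-sol ∷ sols))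
  where open import Data.List.Membership.DecPropositional (Vecₚ.≡-dec ℚ._≟_) using (_∈?_)

¬distinct⇒finite : ∀ {p} (D : Poly p) → Decidable (HasDistinctRatSols D) →
  ∀ n → ¬ HasDistinctRatSols D n → FinitelyManyRatSols D
¬distinct⇒finite D distinct? n ¬Dn with ∃-boundary distinct? ([] , refl , [] , []) n ¬Dn
... | k , Dk , ¬Dsk = maximal⇒finite D Dk ¬Dsk

fewer⇒¬distinct : ∀ {p} (D : Poly p) b → NumRatSols< D b → ¬ HasDistinctRatSols D b
fewer⇒¬distinct D b fewer (L , refl , unique , sols) = <-irrefl refl (fewer L unique sols)

dec-from-Bool : ∀ {P : Set} b → (b ≡ true → P) → (P → b ≡ true) → Dec P
dec-from-Bool true  b⇒P _   = yes (b⇒P refl)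
dec-from-Bool false _   P⇒b = no λ p → case P⇒b p of λ ()

not-true⇔¬ : ∀ {P : Set} b → (b ≡ true → P) → (P → b ≡ true) → (not b ≡ true → ¬ P) × (¬ P → not b ≡ true)
not-true⇔¬ true  b⇒P _   = (λ ()) , λ ¬p → ⊥-elim (¬p (b⇒P refl))
not-true⇔¬ false _   P⇒b = (λ _ p → case P⇒b p of λ ()) , λ _ → refl

oracle⇒distinct? : ∀ {O} → IsRatSolvabilityOracle O → ∀ {p} (D : Poly p) → Decidable (HasDistinctRatSols D)
oracle⇒distinct? correct D k = map′ (system-sound D k) (system-complete D k)
  (dec-from-Bool _ (proj₁ (correct _ (system D k))) (proj₂ (correct _ _)))

theorem9 : (B : (p : ℕ) → Poly p → ℕ) →
    (∀ p (D : Poly p) → 2 ≤ B p D) →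
    (∀ p (D : Poly p) → FinitelyManyRatSols D → NumRatSols< D (B p D)) →
    Σ ((p : ℕ) → Poly p → Σ ℕ Poly) λ T →
    Σ ((p : ℕ) → Poly p → Bool → Bool) λ g →
      ∀ (O : (q : ℕ) → Poly q → Bool) → IsRatSolvabilityOracle O →
      ∀ p (D : Poly p) →
        (g p D (O (Σ.proj₁ (T p D)) (Σ.proj₂ (T p D))) ≡ true → FinitelyManyRatSols D)
        × (FinitelyManyRatSols D → g p D (O (Σ.proj₁ (T p D)) (Σ.proj₂ (T p D))) ≡ true)
theorem9 B _ B-bounds = (λ p D → #vars p (B p D) , system D (B p D)) , (λ _ _ → not) , λ O correct p D →
  let b = B p D
      (refuted⇒unsolvable , unsolvable⇒refuted) =
        not-true⇔¬ _ (proj₁ (correct _ (system D b))) (proj₂ (correct _ _))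
  in (λ refuted → ¬distinct⇒finite D (oracle⇒distinct? correct D) b
                    (refuted⇒unsolvable refuted ∘ system-complete D b))
   , (λ finite → unsolvable⇒refuted (fewer⇒¬distinct D b (B-bounds p D finite) ∘ system-sound D b))
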